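{- For every integer $n\ge 2$, $$\mathrm{spt}1_{do}(n)=2p_{de}(n-1)+p_{do}(n-1)\qquad\text{and}\qquad \mathrm{spt}1'_{do}(n)=-p'_{do}(n-1).$$
   Context: For a partition $\pi$, $s(\pi)$ is its smallest part. $\mathrm{Spt}1_{do}(n)$ is the set of partitions $\pi$ of $n$ in which $s(\pi)$ occurs exactly once and the remaining parts are pairwise distinct and each has parity different from that of $s(\pi)$. $B_0(1,n)$ (resp. $B_1(1,n)$) is the number of $\pi\in\mathrm{Spt}1_{do}(n)$ whose number of parts greater than $s(\pi)$ is even (resp. odd); $\mathrm{spt}1_{do}(n)=B_0(1,n)+B_1(1,n)$ and $\mathrm{spt}1'_{do}(n)=B_0(1,n)-B_1(1,n)$. $p_{de}(n)$ (resp. $p_{do}(n)$) is the number of partitions of $n$ into distinct even (resp. distinct odd) parts; $p'_{do}(n)$ is the number of partitions of $n$ into distinct odd parts with an even number of parts minus the number with an odd number of parts; all equal $1$ at $n=0$. -}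

module Defs where

open import Data.Bool.Base using (true; false; if_then_else_; T)
open import Data.Integer.Base using (ℤ; +_; _-_)
open import Data.List.Base using (List; []; _∷_; _++_; map; filter; length)
open import Data.List.Extrema.Nat using (min)
open import Data.List.Membership.Propositional using (_∈_)
open import Data.List.Membership.Propositional.Properties using (∈-map⁺; ∈-map⁻; ∈-++⁺ˡ; ∈-++⁺ʳ; ∈-++⁻)
open import Data.List.Properties using (∷-injectiveʳ)
open import Data.List.Relation.Unary.All as All using (All; []; _∷_)
open import Data.List.Relation.Unary.AllPairs using ([]; _∷_)
open import Data.List.Relation.Unary.Any using (here)
open import Data.List.Relation.Unary.Linked as Linked using (Linked; []; [-]; _∷_)
open import Data.List.Relation.Unary.Unique.DecPropositional using (unique?)
open import Data.List.Relation.Unary.Unique.Propositional using (Unique)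
open import Data.List.Relation.Unary.Unique.Propositional.Properties using (map⁺; ++⁺)
open import Data.Nat.Base using (ℕ; zero; suc; _+_; _∸_; _≤_; _<_; _≥_; _≤ᵇ_; z≤n; s≤s; parity)
open import Data.Nat.ListAction using (sum)
open import Data.Nat.Properties
open import Data.Parity.Base using (0ℙ; 1ℙ)
open import Data.Parity.Properties using () renaming (_≟_ to _≟ℙ_)
open import Data.Product.Base using (_×_; _,_; proj₁; proj₂)
open import Data.Sum.Base using (inj₁; inj₂)
open import Data.Empty using (⊥-elim)
open import Relation.Binary.PropositionalEquality using (_≡_; _≢_; refl; sym; trans; cong; subst)
open import Relation.Nullary.Decidable using (yes; no; _×-dec_; ¬?)
open import Relation.Unary using (Pred; Decidable)
open import Level using (0ℓ)

IsPartition : ℕ → List ℕ → Set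
IsPartition n π = Linked _≥_ π × All (0 <_) π × sum π ≡ n

-- The partitions of n with at most l parts, each at most m
-- (see partitions-sound, partitions-complete, partitions-unique).
boundedPartitions : (l m n : ℕ) → List (List ℕ)
boundedPartitions l       m       zero    = [] ∷ []
boundedPartitions zero    m       (suc n) = []
boundedPartitions (suc l) zero    (suc n) = []
boundedPartitions (suc l) (suc m) (suc n) =
  (if m ≤ᵇ n then map (suc m ∷_) (boundedPartitions l (suc m) (n ∸ m)) else [])
  ++ boundedPartitions (suc l) m (suc n)

partitions : ℕ → List (List ℕ)
partitions n = boundedPartitions n n n

private
  raise : ∀ {m π} → Linked _≥_ (m ∷ π) → Linked _≥_ (suc m ∷ π)
  raise [-]      = [-]
  raise (p ∷ ps) = m≤n⇒m≤1+n p ∷ ps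

  boundedSound : ∀ l m n {π} → π ∈ boundedPartitions l m n →
                 Linked _≥_ (m ∷ π) × All (0 <_) π × sum π ≡ n
  boundedSound l m zero (here refl) = [-] , [] , refl
  boundedSound (suc l) (suc m) (suc n) π∈ with m ≤ᵇ n in eq
  ... | false with boundedSound (suc l) m (suc n) π∈
  ...   | d , p , s = raise d , p , s
  boundedSound (suc l) (suc m) (suc n) π∈ | true
    with ∈-++⁻ (map (suc m ∷_) (boundedPartitions l (suc m) (n ∸ m))) π∈
  ... | inj₂ q with boundedSound (suc l) m (suc n) q
  ...   | d , p , s = raise d , p , s
  boundedSound (suc l) (suc m) (suc n) π∈ | true | inj₁ q
    with ∈-map⁻ (suc m ∷_) q
  ... | ρ , ρ∈ , refl with boundedSound l (suc m) (n ∸ m) ρ∈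
  ...   | d , p , s = (≤-refl ∷ d) , (s≤s z≤n ∷ p)
        , cong suc (trans (cong (λ k → m + k) s)
            (m+[n∸m]≡n (≤ᵇ⇒≤ m n (subst T (sym eq) _))))

  boundedComplete : ∀ l m n {π} → length π ≤ l → Linked _≥_ (m ∷ π) →
                    All (0 <_) π → sum π ≡ n → π ∈ boundedPartitions l m n
  boundedComplete l m zero {[]} _ _ _ _ = here refl
  boundedComplete l m zero {suc x ∷ π} _ _ _ ()
  boundedComplete l m zero {zero ∷ π} _ _ (() ∷ _) _
  boundedComplete (suc l) zero (suc n) {x ∷ π} _ (z≤n ∷ _) (() ∷ _) _
  boundedComplete (suc l) (suc m) (suc n) {zero ∷ π} _ _ (() ∷ _) _
  boundedComplete (suc l) (suc m) (suc n) {suc x ∷ π} (s≤s len) (s≤s x≤m ∷ d) (p ∷ ps) s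
    with x ≟ m
  ... | no x≢m = ∈-++⁺ʳ (if m ≤ᵇ n then map (suc m ∷_) (boundedPartitions l (suc m) (n ∸ m)) else [])
                   (boundedComplete (suc l) m (suc n) (s≤s len) (≤∧≢⇒< x≤m x≢m ∷ d) (p ∷ ps) s)
  ... | yes refl with m ≤ᵇ n in eq
  ...   | true  = ∈-++⁺ˡ (∈-map⁺ (suc m ∷_) (boundedComplete l (suc m) (n ∸ m) len d ps
                    (trans (sym (m+n∸m≡n m (sum π))) (cong (_∸ m) (suc-injective s)))))
  ...   | false = ⊥-elim (subst T eq (≤⇒≤ᵇ (subst (m ≤_) (suc-injective s) (m≤m+n m (sum π)))))

  boundedUnique : ∀ l m n → Unique (boundedPartitions l m n)
  boundedUnique l       m       zero    = [] ∷ []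
  boundedUnique zero    m       (suc n) = []
  boundedUnique (suc l) zero    (suc n) = []
  boundedUnique (suc l) (suc m) (suc n) with m ≤ᵇ n
  ... | false = boundedUnique (suc l) m (suc n)
  ... | true  = ++⁺ (map⁺ ∷-injectiveʳ (boundedUnique l (suc m) (n ∸ m)))
                    (boundedUnique (suc l) m (suc n)) disjoint
    where
    disjoint : ∀ {π} → π ∈ map (suc m ∷_) (boundedPartitions l (suc m) (n ∸ m))
                     × π ∈ boundedPartitions (suc l) m (suc n) → _
    disjoint (q , r) with ∈-map⁻ (suc m ∷_) q
    ... | _ , _ , refl with proj₁ (boundedSound (suc l) m (suc n) r)
    ...   | m<m ∷ _ = 1+n≰n m<m

  length≤sum : ∀ {π} → All (0 <_) π → length π ≤ sum π
  length≤sum []       = z≤n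
  length≤sum (p ∷ ps) = +-mono-≤ p (length≤sum ps)

  bounded : ∀ {π} → Linked _≥_ π → Linked _≥_ (sum π ∷ π)
  bounded {[]}    _ = [-]
  bounded {x ∷ π} d = m≤m+n x (sum π) ∷ d

partitions-sound : ∀ n {π} → π ∈ partitions n → IsPartition n π
partitions-sound n π∈ with boundedSound n n n π∈
... | d , p , s = Linked.tail d , p , s

partitions-complete : ∀ n {π} → IsPartition n π → π ∈ partitions n
partitions-complete _ (d , p , refl) =
  boundedComplete _ _ _ (length≤sum p) (bounded d) p refl

partitions-unique : ∀ n → Unique (partitions n)
partitions-unique n = boundedUnique n n n

#partitions : ∀ {P : Pred (List ℕ) 0ℓ} → Decidable P → ℕ → ℕ
#partitions P? n = length (filter P? (partitions n))

-- The value at [] is junk; IsSpt1do fails for [], as 0 does not occur in it.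
smallest : List ℕ → ℕ
smallest []       = 0
smallest (x ∷ xs) = min x xs

occurrences : ℕ → List ℕ → ℕ
occurrences k π = length (filter (k ≟_) π)

remainingParts : List ℕ → List ℕ
remainingParts π = filter (λ x → ¬? (smallest π ≟ x)) π

#larger : List ℕ → ℕ
#larger π = length (filter (smallest π <?_) π)

IsSpt1do : List ℕ → Set
IsSpt1do π = occurrences (smallest π) π ≡ 1
           × Unique (remainingParts π)
           × All (λ x → parity x ≢ parity (smallest π)) (remainingParts π)

isSpt1do? : Decidable IsSpt1do
isSpt1do? π = (occurrences (smallest π) π ≟ 1)
  ×-dec unique? _≟_ (remainingParts π)
  ×-dec All.all? (λ x → ¬? (parity x ≟ℙ parity (smallest π))) (remainingParts π)

B₀1 : ℕ → ℕ
B₀1 = #partitions (λ π → isSpt1do? π ×-dec (parity (#larger π) ≟ℙ 0ℙ))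

B₁1 : ℕ → ℕ
B₁1 = #partitions (λ π → isSpt1do? π ×-dec (parity (#larger π) ≟ℙ 1ℙ))

spt1do : ℕ → ℕ
spt1do n = B₀1 n + B₁1 n

spt1do′ : ℕ → ℤ
spt1do′ n = + B₀1 n - + B₁1 n

DistinctEven : List ℕ → Set
DistinctEven π = Unique π × All (λ x → parity x ≡ 0ℙ) π

DistinctOdd : List ℕ → Set
DistinctOdd π = Unique π × All (λ x → parity x ≡ 1ℙ) π

distinctEven? : Decidable DistinctEven
distinctEven? π = unique? _≟_ π ×-dec All.all? (λ x → parity x ≟ℙ 0ℙ) π

distinctOdd? : Decidable DistinctOdd
distinctOdd? π = unique? _≟_ π ×-dec All.all? (λ x → parity x ≟ℙ 1ℙ) π

pde : ℕ → ℕ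
pde = #partitions distinctEven?

pdo : ℕ → ℕ
pdo = #partitions distinctOdd?

pdo′ : ℕ → ℤ
pdo′ n = + #partitions (λ π → distinctOdd? π ×-dec (parity (length π) ≟ℙ 0ℙ)) n
       - + #partitions (λ π → distinctOdd? π ×-dec (parity (length π) ≟ℙ 1ℙ)) n

pde-zero : pde 0 ≡ 1
pde-zero = refl

pdo-zero : pdo 0 ≡ 1
pdo-zero = refl

pdo′-zero : pdo′ 0 ≡ + 1
pdo′-zero = refl

{-# OPTIONS --safe #-}

-- Lower the smallest part s of a partition in Spt1do(n) by one.  The parts
-- above s have the parity of s − 1 and hence exceed s as soon as they exceed
-- s − 1, so the result is a partition of n − 1 into distinct parts of one
-- parity, possibly with an extra part 0.  For n ≥ 2 this is a bijection:
-- s = 1 yields all partitions into distinct even parts, odd s ≥ 3 yields them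
-- a second time, and even s yields the partitions into distinct odd parts.
-- The number of parts above s is the length of the image for s = 1 and one
-- less otherwise, so in the signed count the two even families cancel.
module Submission where

open import Defs
open import Data.Nat.Base using (ℕ; _+_; _*_; _∸_; _≤_)
open import Data.Integer.Base using (-_)
open import Data.Product.Base using (_×_)
open import Relation.Binary.PropositionalEquality using (_≡_)

open import Data.Integer.Base as ℤ using (+_)
import Data.Integer.Tactic.RingSolver as ℤ-Solver
open import Data.List.Base using (List; []; _∷_; _++_; _∷ʳ_; _∷ʳ′_; filter; initLast; length; map)
open import Data.List.Extrema.Nat using (min≈v⁺)
open import Data.List.Membership.Propositional using (_∈_)
open import Data.List.Membership.Propositional.Properties using (∈-++⁺ˡ; ∈-++⁺ʳ; ∈-++⁻; ∈-filter⁺; ∈-filter⁻; ∈-map⁺; ∈-map⁻)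
open import Data.List.Membership.Propositional.Properties.WithK using (unique∧set⇒bag)
open import Data.List.Properties using (filter-++; filter-accept; filter-all; filter-none; filter-reject; filter-some; length-++; length-map; ∷ʳ-injectiveʳ; ∷ʳ-injectiveˡ; ++-identityʳ)
open import Data.List.Relation.Binary.BagAndSetEquality using (∼bag⇒↭)
open import Data.List.Relation.Binary.Permutation.Propositional.Properties using (↭-length)
open import Data.List.Relation.Unary.All as All using (All; []; _∷_)
open import Data.List.Relation.Unary.All.Properties using (∷ʳ⁺; ∷ʳ⁻; ¬Any⇒All¬)
open import Data.List.Relation.Unary.AllPairs as AllPairs using (AllPairs; []; _∷_)
open import Data.List.Relation.Unary.Any using (here)
open import Data.List.Relation.Unary.Linked using (Linked)
open import Data.List.Relation.Unary.Linked.Properties using (AllPairs⇒Linked; Linked⇒AllPairs)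
open import Data.List.Relation.Unary.Unique.DecPropositional using (unique?)
open import Data.List.Relation.Unary.Unique.Propositional using (Unique)
import Data.List.Relation.Unary.Unique.Propositional.Properties as Unique
open import Data.Nat.Base using (zero; suc; _<_; _>_; _≥_; z≤n; s≤s; parity)
open import Data.Nat.ListAction using (sum)
open import Data.Nat.ListAction.Properties using (sum-++)
open import Data.Nat.Properties using (_≟_; _<?_; +-comm; +-identityʳ; +-suc; <⇒≤; <⇒≢; <-irrefl; <-trans; n<1+n; suc-injective; ≤-refl; ≤-trans; ≤∧≢⇒<)
import Data.Nat.Tactic.RingSolver as ℕ-Solver
open import Data.Parity.Base using (Parity; 0ℙ; 1ℙ; _⁻¹)
open import Data.Parity.Properties using (suc-homo-⁻¹; ⁻¹-selfInverse) renaming (_≟_ to _≟ℙ_)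
open import Data.Product.Base using (_,_; proj₁; proj₂)
open import Data.Sum.Base using (inj₁; inj₂)
open import Function.Base using (_∘_)
open import Function.Bundles using (mk⇔)
open import Level using (0ℓ)
open import Relation.Binary.Core using (Rel)
open import Relation.Binary.PropositionalEquality using (_≢_; refl; sym; trans; cong; cong₂; subst; module ≡-Reasoning)
open import Relation.Nullary using (¬_; contradiction)
open import Relation.Nullary.Decidable using (yes; no; _×-dec_; ¬?)
open import Relation.Unary using (Pred; Decidable)

private
  variable
    A : Set
    k n s : ℕ
    p q : Parity
    π ρ : List ℕ

-- Counting in lists, and lists with a distinguished last element.

-- Without repetitions, equality as sets is equality as bags, and this gives a permutation. A
-- bijective count thus reduces to two inclusions.
length-unique : {xs ys : List A} → Unique xs → Unique ys →
                (∀ {x} → x ∈ xs → x ∈ ys) → (∀ {x} → x ∈ ys → x ∈ xs) →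
                length xs ≡ length ys
length-unique xs! ys! xs⊆ys ys⊆xs =
  ↭-length (∼bag⇒↭ (unique∧set⇒bag xs! ys! (mk⇔ xs⊆ys ys⊆xs)))

length-filter-parity : {P : Pred A 0ℓ} (P? : Decidable P) (f : A → Parity) (xs : List A) →
  length (filter P? xs) ≡ length (filter (λ x → P? x ×-dec (f x ≟ℙ 0ℙ)) xs)
                        + length (filter (λ x → P? x ×-dec (f x ≟ℙ 1ℙ)) xs)
length-filter-parity P? f []       = refl
length-filter-parity P? f (x ∷ xs) with P? x
... | no  _ = length-filter-parity P? f xs
... | yes _ with f x
...   | 0ℙ = cong suc (length-filter-parity P? f xs)
...   | 1ℙ = trans (cong suc (length-filter-parity P? f xs)) (sym (+-suc _ _))

AllPairs-∷ʳ⁺ : {R : Rel A 0ℓ} {xs : List A} {x : A} →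
               AllPairs R xs → All (λ y → R y x) xs → AllPairs R (xs ∷ʳ x)
AllPairs-∷ʳ⁺ []         []         = [] ∷ []
AllPairs-∷ʳ⁺ (rs ∷ rss) (ry ∷ rys) = ∷ʳ⁺ rs ry ∷ AllPairs-∷ʳ⁺ rss rys

AllPairs-∷ʳ⁻ : {R : Rel A 0ℓ} {x : A} (xs : List A) →
               AllPairs R (xs ∷ʳ x) → AllPairs R xs × All (λ y → R y x) xs
AllPairs-∷ʳ⁻ []       _          = [] , []
AllPairs-∷ʳ⁻ (y ∷ xs) (rs ∷ rss) with ∷ʳ⁻ rs | AllPairs-∷ʳ⁻ xs rss
... | ry , rx | rss′ , rys = ry ∷ rss′ , rx ∷ rys

length-∷ʳ : (xs : List A) (x : A) → length (xs ∷ʳ x) ≡ suc (length xs)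
length-∷ʳ xs x = trans (length-++ xs) (+-comm (length xs) 1)

sum-∷ʳ-suc : ∀ ρ k → sum (ρ ∷ʳ suc k) ≡ suc (sum (ρ ∷ʳ k))
sum-∷ʳ-suc ρ k = begin
  sum (ρ ∷ʳ suc k)      ≡⟨ sum-++ ρ (suc k ∷ []) ⟩
  sum ρ + suc (k + 0)   ≡⟨ +-suc (sum ρ) (k + 0) ⟩
  suc (sum ρ + (k + 0)) ≡⟨ cong suc (sum-++ ρ (k ∷ [])) ⟨
  suc (sum (ρ ∷ʳ k))    ∎
  where open ≡-Reasoning

sum-∷ʳ-0 : ∀ ρ → sum (ρ ∷ʳ 0) ≡ sum ρ
sum-∷ʳ-0 ρ = trans (sum-++ ρ (0 ∷ [])) (+-identityʳ (sum ρ))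

-- Parity, and decreasing chains of one parity.

parity-suc : ∀ n → parity (suc n) ≡ parity n ⁻¹
parity-suc n = sym (⁻¹-selfInverse (suc-homo-⁻¹ n))

≢⇒≡⁻¹ : p ≢ q → p ≡ q ⁻¹
≢⇒≡⁻¹ {0ℙ} {0ℙ} p≢q = contradiction refl p≢q
≢⇒≡⁻¹ {0ℙ} {1ℙ} p≢q = refl
≢⇒≡⁻¹ {1ℙ} {0ℙ} p≢q = refl
≢⇒≡⁻¹ {1ℙ} {1ℙ} p≢q = contradiction refl p≢q

≡⁻¹⇒≢ : p ≡ q ⁻¹ → p ≢ q
≡⁻¹⇒≢ {0ℙ} {1ℙ} _ ()
≡⁻¹⇒≢ {1ℙ} {0ℙ} _ ()

-- The common form of both sides. With `k = 0` it describes partitions into distinct parts of parity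
-- `q`; with `k = s` and `q = parity s ⁻¹`, the parts above the smallest part `s` of a partition
-- counted by `spt1do`.
Chain : Parity → ℕ → List ℕ → Set
Chain q k ρ = AllPairs _>_ ρ × All (k <_) ρ × All (λ x → parity x ≡ q) ρ

-- No number of the parity of `k` equals `suc k`, so the bound rises at no cost. This makes the
-- lowering of the smallest part reversible.
chain-raise : Chain (parity k) k ρ → Chain (parity k) (suc k) ρ
chain-raise {k} (ρ> , k<ρ , par) = ρ> , All.zipWith raise (k<ρ , par) , par
  where
  raise : ∀ {x} → k < x × parity x ≡ parity k → suc k < x
  raise (k<x , eq) = ≤∧≢⇒< k<x λ { refl → ≡⁻¹⇒≢ (parity-suc k) eq }

chain-lower : Chain q (suc k) ρ → Chain q k ρ
chain-lower (ρ> , k<ρ , par) = ρ> , All.map (<-trans (n<1+n _)) k<ρ , par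

chain-∷ʳ⁺ : 0 < k → Chain (parity k) k ρ → Chain (parity k) 0 (ρ ∷ʳ k)
chain-∷ʳ⁺ 0<k (ρ> , k<ρ , par) =
  AllPairs-∷ʳ⁺ ρ> k<ρ , ∷ʳ⁺ (All.map (<-trans 0<k) k<ρ) 0<k , ∷ʳ⁺ par refl

chain-∷ʳ⁻ : ∀ ρ → Chain q 0 (ρ ∷ʳ k) → 0 < k × parity k ≡ q × Chain q k ρ
chain-∷ʳ⁻ ρ (ρ> , 0<ρ , par) with AllPairs-∷ʳ⁻ ρ ρ> | ∷ʳ⁻ 0<ρ | ∷ʳ⁻ par
... | ρ>′ , k<ρ | _ , 0<k | par′ , eq = 0<k , eq , ρ>′ , k<ρ , par′

-- At `0ℙ` and `1ℙ` this unfolds to `DistinctEven` and `DistinctOdd`, and `distinct?` to their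
-- decision procedures, so the counts below agree with `pde`, `pdo` and `pdo′` by computation.
Distinct : Parity → List ℕ → Set
Distinct q π = Unique π × All (λ x → parity x ≡ q) π

distinct? : ∀ q → Decidable (Distinct q)
distinct? q π = unique? _≟_ π ×-dec All.all? (λ x → parity x ≟ℙ q) π

≥∧Unique⇒> : AllPairs _≥_ π → Unique π → AllPairs _>_ π
≥∧Unique⇒> ≥s ≢s = AllPairs.zipWith (λ (y≤x , x≢y) → ≤∧≢⇒< y≤x (x≢y ∘ sym)) (≥s , ≢s)

>⇒Unique : AllPairs _>_ π → Unique π
>⇒Unique = AllPairs.map (λ y<x → <⇒≢ y<x ∘ sym)


Linked⇒AllPairs-≥ : Linked _≥_ π → AllPairs _≥_ π
Linked⇒AllPairs-≥ = Linked⇒AllPairs (λ y≤x z≤y → ≤-trans z≤y y≤x)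

distinct⇒chain : IsPartition n π → Distinct q π → Chain q 0 π
distinct⇒chain (≥s , 0<π , _) (π! , par) =
  ≥∧Unique⇒> (Linked⇒AllPairs-≥ ≥s) π! , 0<π , par

chain⇒distinct : Chain q 0 π → sum π ≡ n → IsPartition n π × Distinct q π
chain⇒distinct (π> , 0<π , par) Σ≡n =
  (AllPairs⇒Linked (AllPairs.map <⇒≤ π>) , 0<π , Σ≡n) , >⇒Unique π> , par

-- Membership in `IsSpt1do`, read off with the last part split off.

smallest-∷ʳ : All (s ≤_) ρ → smallest (ρ ∷ʳ s) ≡ s
smallest-∷ʳ []                      = refl
smallest-∷ʳ {ρ = x ∷ ρ} (s≤x ∷ s≤ρ) = min≈v⁺ (∈-++⁺ʳ ρ (here refl)) (∷ʳ⁺ s≤ρ ≤-refl) s≤x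

filter-∷ʳ-accept : {P : Pred A 0ℓ} (P? : Decidable P) (xs : List A) {x : A} → P x →
                   filter P? (xs ∷ʳ x) ≡ filter P? xs ∷ʳ x
filter-∷ʳ-accept P? xs px =
  trans (filter-++ P? xs _) (cong (filter P? xs ++_) (filter-accept P? px))

filter-∷ʳ-reject : {P : Pred A 0ℓ} (P? : Decidable P) (xs : List A) {x : A} → ¬ P x →
                   filter P? (xs ∷ʳ x) ≡ filter P? xs
filter-∷ʳ-reject P? xs ¬px =
  trans (filter-++ P? xs _) (trans (cong (filter P? xs ++_) (filter-reject P? ¬px)) (++-identityʳ _))

length-filter≡0⇒none : {P : Pred A 0ℓ} (P? : Decidable P) (xs : List A) →
                       length (filter P? xs) ≡ 0 → All (¬_ ∘ P) xs
length-filter≡0⇒none P? xs eq = ¬Any⇒All¬ xs λ any → <-irrefl (sym eq) (filter-some P? any)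

occurrences-∷ʳ : ∀ s ρ → occurrences s (ρ ∷ʳ s) ≡ suc (occurrences s ρ)
occurrences-∷ʳ s ρ = trans (cong length (filter-∷ʳ-accept (s ≟_) ρ refl)) (length-∷ʳ (filter (s ≟_) ρ) s)

remainingParts-∷ʳ : All (s <_) ρ → remainingParts (ρ ∷ʳ s) ≡ ρ
remainingParts-∷ʳ {s} {ρ} s<ρ rewrite smallest-∷ʳ (All.map <⇒≤ s<ρ) =
  trans (filter-∷ʳ-reject (λ x → ¬? (s ≟ x)) ρ (λ s≢s → s≢s refl))
        (filter-all (λ x → ¬? (s ≟ x)) (All.map <⇒≢ s<ρ))

#larger-∷ʳ : All (s <_) ρ → #larger (ρ ∷ʳ s) ≡ length ρ
#larger-∷ʳ {s} {ρ} s<ρ rewrite smallest-∷ʳ (All.map <⇒≤ s<ρ) =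
  cong length (trans (filter-∷ʳ-reject (s <?_) ρ (<-irrefl refl)) (filter-all (s <?_) s<ρ))

-- The last part of a weakly decreasing list is its minimum. As it occurs only once, the bound on
-- `ρ` becomes strict; only then are the remaining parts known to be `ρ` itself, and the conditions
-- on them carry over.
spt⇒chain : ∀ ρ → IsPartition n (ρ ∷ʳ s) → IsSpt1do (ρ ∷ʳ s) →
            0 < s × Chain (parity s ⁻¹) s ρ
spt⇒chain {s = s} ρ (≥s , 0<π , _) (once , rest! , par)
  with AllPairs-∷ʳ⁻ ρ (Linked⇒AllPairs-≥ ≥s)
... | ρ≥ , s≤ρ = proj₂ (∷ʳ⁻ 0<π) , ≥∧Unique⇒> ρ≥ (subst Unique rest≡ρ rest!) , s<ρ , par′
  where
  once′ : occurrences s (ρ ∷ʳ s) ≡ 1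
  once′ = subst (λ m → occurrences m (ρ ∷ʳ s) ≡ 1) (smallest-∷ʳ s≤ρ) once

  s≢ρ : All (s ≢_) ρ
  s≢ρ = length-filter≡0⇒none (s ≟_) ρ
          (suc-injective (trans (sym (occurrences-∷ʳ s ρ)) once′))

  s<ρ : All (s <_) ρ
  s<ρ = All.zipWith (λ (s≤x , s≢x) → ≤∧≢⇒< s≤x s≢x) (s≤ρ , s≢ρ)

  rest≡ρ : remainingParts (ρ ∷ʳ s) ≡ ρ
  rest≡ρ = remainingParts-∷ʳ s<ρ

  par′ : All (λ x → parity x ≡ parity s ⁻¹) ρ
  par′ = All.map (λ ne → ≢⇒≡⁻¹ (ne ∘ λ eq → trans eq (cong parity (sym (smallest-∷ʳ s≤ρ)))))
           (subst (All _) rest≡ρ par)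

chain⇒spt : 0 < s → Chain (parity s ⁻¹) s ρ → sum (ρ ∷ʳ s) ≡ n →
            IsPartition n (ρ ∷ʳ s) × IsSpt1do (ρ ∷ʳ s)
chain⇒spt {s} {ρ} 0<s (ρ> , s<ρ , par) Σ≡n =
  (AllPairs⇒Linked (AllPairs.map <⇒≤ (AllPairs-∷ʳ⁺ ρ> s<ρ))
    , ∷ʳ⁺ (All.map (<-trans 0<s) s<ρ) 0<s , Σ≡n)
  , once , subst Unique (sym rest≡ρ) (>⇒Unique ρ>) , subst (All _) (sym rest≡ρ) par′
  where
  small≡s : smallest (ρ ∷ʳ s) ≡ s
  small≡s = smallest-∷ʳ (All.map <⇒≤ s<ρ)

  rest≡ρ : remainingParts (ρ ∷ʳ s) ≡ ρ
  rest≡ρ = remainingParts-∷ʳ s<ρ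

  once : occurrences (smallest (ρ ∷ʳ s)) (ρ ∷ʳ s) ≡ 1
  once rewrite small≡s =
    trans (occurrences-∷ʳ s ρ)
          (cong (suc ∘ length) (filter-none (s ≟_) (All.map <⇒≢ s<ρ)))

  par′ : All (λ x → parity x ≢ parity (smallest (ρ ∷ʳ s))) ρ
  par′ rewrite small≡s = All.map ≡⁻¹⇒≢ par

-- Raising the smallest part by one.

-- The inverse of lowering the smallest part, total so that it can be mapped over a list. Fixing
-- `[]` keeps it injective on all lists.
incrementLast : List ℕ → List ℕ
incrementLast []          = []
incrementLast (x ∷ [])    = suc x ∷ []
incrementLast (x ∷ y ∷ π) = x ∷ incrementLast (y ∷ π)

incrementLast-∷ʳ : ∀ ρ k → incrementLast (ρ ∷ʳ k) ≡ ρ ∷ʳ suc k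
incrementLast-∷ʳ []          k = refl
incrementLast-∷ʳ (x ∷ [])    k = refl
incrementLast-∷ʳ (x ∷ y ∷ ρ) k = cong (x ∷_) (incrementLast-∷ʳ (y ∷ ρ) k)

incrementLast-∷ʳ≢[] : ∀ ρ → incrementLast (ρ ∷ʳ k) ≢ []
incrementLast-∷ʳ≢[] []          ()
incrementLast-∷ʳ≢[] (_ ∷ [])    ()
incrementLast-∷ʳ≢[] (_ ∷ _ ∷ _) ()

incrementLast-injective : ∀ {π ρ} → incrementLast π ≡ incrementLast ρ → π ≡ ρ
incrementLast-injective {π} {ρ} eq with initLast π | initLast ρ
... | []      | []      = refl
... | []      | σ ∷ʳ′ k = contradiction (sym eq) (incrementLast-∷ʳ≢[] σ)
... | σ ∷ʳ′ k | []      = contradiction eq (incrementLast-∷ʳ≢[] σ)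
... | σ ∷ʳ′ k | τ ∷ʳ′ l
  with eq′ ← trans (sym (incrementLast-∷ʳ σ k)) (trans eq (incrementLast-∷ʳ τ l))
  = cong₂ _∷ʳ_ (∷ʳ-injectiveˡ σ τ eq′) (suc-injective (∷ʳ-injectiveʳ σ τ eq′))

-- Both families of partitions, refined by a parity of the number of parts.

distinctParts : (q p : Parity) → ℕ → List (List ℕ)
distinctParts q p n = filter (λ π → distinct? q π ×-dec (parity (length π) ≟ℙ p)) (partitions n)

sptParts : Parity → ℕ → List (List ℕ)
sptParts p n = filter (λ π → isSpt1do? π ×-dec (parity (#larger π) ≟ℙ p)) (partitions n)

∈-distinctParts⁻ : ∀ q p n → π ∈ distinctParts q p n → Chain q 0 π × sum π ≡ n × parity (length π) ≡ p
∈-distinctParts⁻ q p n π∈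
  with ∈-filter⁻ (λ π → distinct? q π ×-dec (parity (length π) ≟ℙ p)) π∈
... | π∈′ , dist , par with partitions-sound n π∈′
...   | part = distinct⇒chain part dist , proj₂ (proj₂ part) , par

∈-distinctParts⁺ : Chain q 0 π → sum π ≡ n → parity (length π) ≡ p → π ∈ distinctParts q p n
∈-distinctParts⁺ {n = n} chain Σ≡n par with chain⇒distinct chain Σ≡n
... | part , dist = ∈-filter⁺ _ (partitions-complete n part) (dist , par)

∈-sptParts⁻ : ∀ p n ρ → ρ ∷ʳ s ∈ sptParts p n →
              0 < s × Chain (parity s ⁻¹) s ρ × sum (ρ ∷ʳ s) ≡ n × parity (length ρ) ≡ p
∈-sptParts⁻ p n ρ π∈
  with ∈-filter⁻ (λ π → isSpt1do? π ×-dec (parity (#larger π) ≟ℙ p)) π∈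
... | π∈′ , spt , par with partitions-sound n π∈′
...   | part with spt⇒chain ρ part spt
...     | 0<s , chain@(_ , s<ρ , _) =
  0<s , chain , proj₂ (proj₂ part) , trans (cong parity (sym (#larger-∷ʳ s<ρ))) par

∈-sptParts⁺ : 0 < s → Chain (parity s ⁻¹) s ρ → sum (ρ ∷ʳ s) ≡ n → parity (length ρ) ≡ p →
              ρ ∷ʳ s ∈ sptParts p n
∈-sptParts⁺ {n = n} 0<s chain@(_ , s<ρ , _) Σ≡n par with chain⇒spt 0<s chain Σ≡n
... | part , spt =
  ∈-filter⁺ _ (partitions-complete n part) (spt , trans (cong parity (#larger-∷ʳ s<ρ)) par)

-- The bijection for a fixed parity `p` of the number of larger parts.

module _ (p : Parity) (n : ℕ) where

  private
    -- `withOne` is the case of smallest part 1, where the lowered part vanishes and the length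
    -- keeps parity `p`. `raised` is the case of smallest part at least 2: the lowered part survives
    -- as one more part, whence `p ⁻¹`.
    evenOrOdd withOne raised : List (List ℕ)
    evenOrOdd = distinctParts 0ℙ (p ⁻¹) (suc n) ++ distinctParts 1ℙ (p ⁻¹) (suc n)
    withOne   = map (_∷ʳ 1) (distinctParts 0ℙ p (suc n))
    raised    = map incrementLast evenOrOdd

    distinct! : ∀ q p → Unique (distinctParts q p (suc n))
    distinct! q p = Unique.filter⁺ _ (partitions-unique (suc n))

    ∈-evenOrOdd⁺ : Chain q 0 π → sum π ≡ suc n → parity (length π) ≡ p ⁻¹ → π ∈ evenOrOdd
    ∈-evenOrOdd⁺ {0ℙ} c Σ≡ par = ∈-++⁺ˡ (∈-distinctParts⁺ c Σ≡ par)
    ∈-evenOrOdd⁺ {1ℙ} c Σ≡ par = ∈-++⁺ʳ _ (∈-distinctParts⁺ c Σ≡ par)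

    -- A view of the members of `evenOrOdd` that forgets which of the two families they come from:
    -- the parity of the positive last part `suc k` determines it.
    data Raisable : List ℕ → Set where
      raisable : ∀ ρ k → Chain (parity (suc k)) (suc k) ρ → sum (ρ ∷ʳ suc k) ≡ suc n →
                 parity (length ρ) ≡ p → Raisable (ρ ∷ʳ suc k)

    distinct⇒raisable : ∀ q → π ∈ distinctParts q (p ⁻¹) (suc n) → Raisable π
    distinct⇒raisable {π} q π∈ with ∈-distinctParts⁻ q (p ⁻¹) (suc n) π∈ | initLast π
    -- The empty list needs no clause, since `Σ≡` gives a positive sum.
    ... | chain , Σ≡ , par | ρ ∷ʳ′ k with chain-∷ʳ⁻ ρ chain
    ...   | s≤s {n = j} _ , refl , chain′ = raisable ρ j chain′ Σ≡ par′
      where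
      par′ : parity (length ρ) ≡ p
      par′ = trans (sym (suc-homo-⁻¹ (length ρ)))
               (⁻¹-selfInverse (sym (trans (cong parity (sym (length-∷ʳ ρ k))) par)))

    ∈-evenOrOdd⁻ : π ∈ evenOrOdd → Raisable π
    ∈-evenOrOdd⁻ π∈ with ∈-++⁻ (distinctParts 0ℙ (p ⁻¹) (suc n)) π∈
    ... | inj₁ π∈ˡ = distinct⇒raisable 0ℙ π∈ˡ
    ... | inj₂ π∈ʳ = distinct⇒raisable 1ℙ π∈ʳ

    evenOrOdd! : Unique evenOrOdd
    evenOrOdd! = Unique.++⁺ (distinct! 0ℙ _) (distinct! 1ℙ _) disjoint
      where
      disjoint : ∀ {π} → ¬ (π ∈ distinctParts 0ℙ (p ⁻¹) (suc n) × π ∈ distinctParts 1ℙ (p ⁻¹) (suc n))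
      -- The empty partition has parts of either parity vacuously; only the positive sum `suc n`
      -- keeps it out of both families.
      disjoint {[]}    (π∈ˡ , _)   with ∈-distinctParts⁻ 0ℙ (p ⁻¹) (suc n) π∈ˡ
      ... | _ , () , _
      disjoint {x ∷ _} (π∈ˡ , π∈ʳ)
        with ∈-distinctParts⁻ 0ℙ (p ⁻¹) (suc n) π∈ˡ | ∈-distinctParts⁻ 1ℙ (p ⁻¹) (suc n) π∈ʳ
      ... | (_ , _ , even ∷ _) , _ | (_ , _ , odd ∷ _) , _ = contradiction (trans (sym even) odd) λ ()

    withOne-raised-disjoint : ∀ {π} → ¬ (π ∈ withOne × π ∈ raised)
    withOne-raised-disjoint (π∈ˡ , π∈ʳ) with ∈-map⁻ (_∷ʳ 1) π∈ˡ | ∈-map⁻ incrementLast π∈ʳ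
    ... | ρ , _ , refl | σ , σ∈ , eq with ∈-evenOrOdd⁻ σ∈
    -- The last part would be both `1` and `suc (suc k)`.
    ...   | raisable τ k _ _ _ =
      contradiction (∷ʳ-injectiveʳ ρ τ (trans eq (incrementLast-∷ʳ τ (suc k)))) λ ()

    spt⊆ : π ∈ sptParts p (suc (suc n)) → π ∈ withOne ++ raised
    spt⊆ {π} π∈ with initLast π
    ... | [] with partitions-sound (suc (suc n))
                   (proj₁ (∈-filter⁻ (λ π → isSpt1do? π ×-dec (parity (#larger π) ≟ℙ p)) π∈))
    ...   | _ , _ , ()
    spt⊆ π∈ | ρ ∷ʳ′ s with ∈-sptParts⁻ p (suc (suc n)) ρ π∈
    ...   | s≤s {n = k} _ , chain , Σ≡ , par
      -- The smallest part is `suc k`. The bound and the sum are lowered before `k` is split, as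
      -- both cases need them: for `k = 0` the part is dropped, otherwise it is kept as the new last
      -- part.
      with k | chain-lower (subst (λ q → Chain q (suc k) ρ) (suc-homo-⁻¹ k) chain)
             | suc-injective (trans (sym (sum-∷ʳ-suc ρ k)) Σ≡)
    ...     | zero  | chain′ | Σ≡′ =
      ∈-++⁺ˡ (∈-map⁺ (_∷ʳ 1) (∈-distinctParts⁺ chain′ (trans (sym (sum-∷ʳ-0 ρ)) Σ≡′) par))
    ...     | suc j | chain′ | Σ≡′ =
      ∈-++⁺ʳ withOne (subst (_∈ raised) (incrementLast-∷ʳ ρ (suc j))
        (∈-map⁺ incrementLast (∈-evenOrOdd⁺ (chain-∷ʳ⁺ (s≤s z≤n) chain′) Σ≡′ par′)))
      where
      par′ : parity (length (ρ ∷ʳ suc j)) ≡ p ⁻¹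
      par′ = trans (cong parity (length-∷ʳ ρ (suc j)))
               (trans (parity-suc (length ρ)) (cong _⁻¹ par))

    -- Serves both halves of the image: `k = 0` stands for a phantom part 0 below an even partition,
    -- which becomes the part 1 of `withOne`, and positive `k` covers `raised`.
    raise∈ : ∀ {ρ k} → Chain (parity k) k ρ → sum (ρ ∷ʳ k) ≡ suc n → parity (length ρ) ≡ p →
             ρ ∷ʳ suc k ∈ sptParts p (suc (suc n))
    raise∈ {ρ} {k} chain Σ≡ par = ∈-sptParts⁺ (s≤s z≤n)
      (subst (λ q → Chain q (suc k) ρ) (sym (suc-homo-⁻¹ k)) (chain-raise chain))
      (trans (sum-∷ʳ-suc ρ k) (cong suc Σ≡)) par

    ⊆spt : π ∈ withOne ++ raised → π ∈ sptParts p (suc (suc n))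
    ⊆spt π∈ with ∈-++⁻ withOne π∈
    ... | inj₁ π∈ˡ with ∈-map⁻ (_∷ʳ 1) π∈ˡ
    ...   | ρ , ρ∈ , refl with ∈-distinctParts⁻ 0ℙ p (suc n) ρ∈
    ...     | chain , Σ≡ , par = raise∈ chain (trans (sum-∷ʳ-0 ρ) Σ≡) par
    ⊆spt π∈ | inj₂ π∈ʳ with ∈-map⁻ incrementLast π∈ʳ
    ...   | σ , σ∈ , refl with ∈-evenOrOdd⁻ σ∈
    ...     | raisable ρ k chain Σ≡ par rewrite incrementLast-∷ʳ ρ (suc k) = raise∈ chain Σ≡ par

  -- Taken at both parities `p`, this yields both identities: each even class occurs once in `B₀1`
  -- and once in `B₁1`, hence twice in the sum and not at all in the difference. The odd classes
  -- occur once each, with parity flipped, which gives the minus sign.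
  length-sptParts : length (sptParts p (suc (suc n)))
    ≡ length (distinctParts 0ℙ p (suc n))
    + (length (distinctParts 0ℙ (p ⁻¹) (suc n)) + length (distinctParts 1ℙ (p ⁻¹) (suc n)))
  length-sptParts = begin
    length (sptParts p (suc (suc n)))
      ≡⟨ length-unique (Unique.filter⁺ _ (partitions-unique (suc (suc n)))) image! spt⊆ ⊆spt ⟩
    length (withOne ++ raised)
      ≡⟨ length-++ withOne ⟩
    length withOne + length raised
      ≡⟨ cong₂ _+_ (length-map (_∷ʳ 1) (distinctParts 0ℙ p (suc n))) (length-map incrementLast evenOrOdd) ⟩
    length (distinctParts 0ℙ p (suc n)) + length evenOrOdd
      ≡⟨ cong (λ l → length (distinctParts 0ℙ p (suc n)) + l) (length-++ (distinctParts 0ℙ (p ⁻¹) (suc n))) ⟩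
    _ ∎
    where
    open ≡-Reasoning

    image! : Unique (withOne ++ raised)
    image! = Unique.++⁺
      (Unique.map⁺ (λ {π} {ρ} → ∷ʳ-injectiveˡ π ρ) (distinct! 0ℙ p))
      (Unique.map⁺ incrementLast-injective evenOrOdd!)
      withOne-raised-disjoint

theorem3p1 : (n : ℕ) → 2 ≤ n →
    (spt1do n ≡ 2 * pde (n ∸ 1) + pdo (n ∸ 1)) × (spt1do′ n ≡ - pdo′ (n ∸ 1))
theorem3p1 (suc (suc n)) (s≤s (s≤s _)) = unsigned , signed
  where
  e₀ e₁ o₀ o₁ : ℕ
  e₀ = length (distinctParts 0ℙ 0ℙ (suc n))
  e₁ = length (distinctParts 0ℙ 1ℙ (suc n))
  o₀ = length (distinctParts 1ℙ 0ℙ (suc n))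
  o₁ = length (distinctParts 1ℙ 1ℙ (suc n))

  regroup : ∀ a b c d → (a + (b + d)) + (b + (a + c)) ≡ 2 * (a + b) + (c + d)
  regroup = ℕ-Solver.solve-∀

  cancel : ∀ a b c d → (a ℤ.+ (b ℤ.+ d)) ℤ.- (b ℤ.+ (a ℤ.+ c)) ≡ - (c ℤ.- d)
  cancel = ℤ-Solver.solve-∀

  unsigned : spt1do (suc (suc n)) ≡ 2 * pde (suc n) + pdo (suc n)
  unsigned = begin
    spt1do (suc (suc n))
      ≡⟨ cong₂ _+_ (length-sptParts 0ℙ n) (length-sptParts 1ℙ n) ⟩
    (e₀ + (e₁ + o₁)) + (e₁ + (e₀ + o₀))
      ≡⟨ regroup e₀ e₁ o₀ o₁ ⟩
    2 * (e₀ + e₁) + (o₀ + o₁)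
      -- `pde` and `pdo` have to be split by the parity of the number of parts; `pdo′` is split by
      -- definition.
      ≡⟨ cong₂ (λ a b → 2 * a + b)
           (length-filter-parity distinctEven? (parity ∘ length) (partitions (suc n)))
           (length-filter-parity distinctOdd? (parity ∘ length) (partitions (suc n))) ⟨
    2 * pde (suc n) + pdo (suc n) ∎
    where open ≡-Reasoning

  signed : spt1do′ (suc (suc n)) ≡ - pdo′ (suc n)
  signed = begin
    spt1do′ (suc (suc n))
      ≡⟨ cong₂ (λ a b → + a ℤ.- + b) (length-sptParts 0ℙ n) (length-sptParts 1ℙ n) ⟩
    + (e₀ + (e₁ + o₁)) ℤ.- + (e₁ + (e₀ + o₀))
      -- Integer addition of two nonnegative values computes to natural addition under `+_`.
      ≡⟨⟩
    (+ e₀ ℤ.+ (+ e₁ ℤ.+ + o₁)) ℤ.- (+ e₁ ℤ.+ (+ e₀ ℤ.+ + o₀))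
      ≡⟨ cancel (+ e₀) (+ e₁) (+ o₀) (+ o₁) ⟩
    - pdo′ (suc n) ∎
    where open ≡-Reasoning
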